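{- Let $l$, $m$, $n$ be positive integers such that $1<l<m\le n$. Then \[ \sum_{d=1}^n \mu(d)\, 2^{\lfloor\frac{n}{d} \rfloor - \lfloor \frac{n-1}{d} \rfloor + \lfloor\frac{m}{d} \rfloor - \lfloor \frac{m-1}{d} \rfloor + \lfloor\frac{l}{d} \rfloor - \lfloor \frac{l-1}{d} \rfloor} \] equals \[ \begin{cases} 4+ M(n) & \text{if } \gcd(l,m)=\gcd(l,n)=\gcd(m,n) =1, \\ 3+ M(n) & \text{if exactly two of the pairs } \{l,m\},\{l,n\},\{m,n\} \text{ are co-prime},\\ 2+ M(n) & \text{if exactly one of these pairs is co-prime},\\ 1 + M(n) & \text{if none of these pairs is co-prime and } \gcd(l,m,n)=1, \\ M(n) & \text{otherwise.} \end{cases} \]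
   Context: $\mu$ is the Möbius function and $M(n)=\sum_{d=1}^n\mu(d)$ is the Mertens function. $\lfloor x\rfloor$ is the floor of $x$. -}

module Defs where

open import Data.Bool.Base using (if_then_else_)
open import Data.Integer.Base using (ℤ; 0ℤ; -1ℤ; _+_; _^_)
open import Data.List.Base using ([]; _∷_; length; filter)
open import Data.List.Relation.Unary.Unique.DecPropositional using (unique?)
open import Data.Nat.Base using (ℕ; zero; suc; NonZero)
open import Data.Nat.Coprimality using (coprime?)
open import Data.Nat.Primality.Factorisation using (factorise; factors)
open import Data.Nat.Properties using (_≟_)
open import Data.Product.Base using (_,_; uncurry)
open import Relation.Nullary.Decidable.Core using (does)

-- The sum over 1 ≤ d ≤ n; the instance argument lets f divide by d.
sum₁ : (n : ℕ) → ((d : ℕ) → .{{NonZero d}} → ℤ) → ℤ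
sum₁ zero    f = 0ℤ
sum₁ (suc n) f = sum₁ n f + f (suc n)

infixl 5 sum₁
syntax sum₁ n (λ d → e) = Σ[1≤ d ≤ n ] e

-- `factors` lists primes with multiplicity, so it is duplicate-free
-- exactly when n is squarefree.
μ : (n : ℕ) → .{{NonZero n}} → ℤ
μ n = let ps = factors (factorise n) in
  if does (unique? _≟_ ps) then -1ℤ ^ length ps else 0ℤ

M : ℕ → ℤ
M n = Σ[1≤ d ≤ n ] μ d

-- The pairs are counted with their labels: when m = n, {l,m} and {l,n}
-- count separately.
#coprimePairs : ℕ → ℕ → ℕ → ℕ
#coprimePairs l m n =
  length (filter (uncurry coprime?) ((l , m) ∷ (l , n) ∷ (m , n) ∷ []))

{-# OPTIONS --safe #-}
-- The exponent is [d ∣ n] + [d ∣ m] + [d ∣ l], and 2^[d ∣ k] = 1 + [d ∣ k]. Since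
-- [d ∣ a] [d ∣ b] = [d ∣ gcd a b], multiplying out gives 1 + Σ [d ∣ k] with k
-- ranging over l, m, n, their pairwise gcds and gcd l m n. Each such k is at most n,
-- so Σ μ(d) [d ∣ k] = [k ≡ 1], and the sum is M n plus the number of gcds equal to 1.
module Submission where

open import Defs
open import Data.Bool.Base using (true; false; if_then_else_)
open import Data.Integer.Base using (ℤ; 0ℤ; 1ℤ; -1ℤ; -_; +_) renaming (_+_ to _+ℤ_; _*_ to _*ℤ_; _^_ to _^ℤ_)
import Data.Integer.Properties as ℤ
open import Algebra.Properties.CommutativeSemigroup ℤ.+-commutativeSemigroup using (interchange)
open import Data.List.Base using (List; []; _∷_; filter; foldr; length)
open import Data.List.Relation.Binary.Permutation.Propositional using (_↭_; ↭-sym; ↭⇒↭ₛ)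
open import Data.List.Relation.Binary.Permutation.Propositional.Properties using (↭-length)
import Data.List.Relation.Binary.Permutation.Setoid.Properties as Permutationₛ
open import Data.List.Relation.Unary.All using (All; []; _∷_)
open import Data.List.Relation.Unary.All.Properties using (All¬⇒¬Any; ¬Any⇒All¬)
open import Data.List.Relation.Unary.AllPairs using (_∷_)
open import Data.List.Relation.Unary.Unique.Propositional using (Unique)
open import Data.List.Relation.Unary.Unique.DecPropositional using (unique?)
open import Data.Nat.Base using (ℕ; zero; suc; NonZero; >-nonZero; >-nonZero⁻¹; ≢-nonZero⁻¹; _+_; _*_; _∸_; _≤_; _<_; _≤′_; ≤′-refl; ≤′-step; z<s; _/_; _%_)
open import Data.Nat.Divisibility
open import Data.Nat.Coprimality using (Coprime; coprime?; coprime-divisor)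
open import Data.Nat.DivMod using (m≡m%n+[m/n]*n; m%n<n; +-distrib-/-∣ʳ; m<n⇒m/n≡0; m*n/n≡m)
open import Data.Nat.GCD using (gcd; gcd[m,n]∣m; gcd[m,n]∣n; gcd-greatest)
open import Data.Nat.ListAction.Properties using (∈⇒∣product)
open import Data.Nat.Primality using (Prime; prime⇒nonZero; prime⇒irreducible)
open import Data.Nat.Primality.Factorisation using (PrimeFactorisation; factorise; factors; factorisationUnique; factorisationHasAllPrimeFactors)
open import Data.Nat.Properties using (_≟_; +-comm; *-comm; ≤-trans; ≤-refl; ≤-<-trans; <-≤-trans; <-trans; <⇒≤; <⇒≢; n<1+n; m≤m*n; m*n≢0; ≤⇒≤′; ≤′⇒≤; m+n∸n≡m; n∸n≡0; m≤n⇒m<n∨m≡n)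
open import Data.Product.Base using (∃-syntax; _×_; _,_; uncurry)
open import Data.Sum.Base using (inj₁; inj₂)
open import Function.Base using (_∘_)
open import Function.Bundles using (_⇔_; mk⇔)
open import Relation.Binary.PropositionalEquality
open import Relation.Nullary.Decidable using (dec-true; dec-false; does-⇔)
open import Relation.Nullary.Decidable.Core using (Dec; yes; no; does; _×-dec_; ¬?)
open import Relation.Nullary.Negation.Core using (¬_; contradiction)

open PrimeFactorisation using (isFactorisation; factorsPrime)

-- Divisibility and its indicator

∤-remainder : ∀ {r d} .{{_ : NonZero r}} q → r < d → d ∤ r + q * d
∤-remainder {r} {d} q r<d d∣ =
  -- Otherwise `d` would divide `r`, although `0 < r < d`.
  >⇒∤ r<d (∣m+n∣m⇒∣n (subst (d ∣_) (+-comm r (q * d)) d∣) (n∣m*n q))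

-- Iverson bracket. It looks at `does` only, so equivalent propositions have equal brackets and a
-- case split needs just the Boolean.
𝟙 : ∀ {P : Set} → Dec P → ℤ
𝟙 P? = if does P? then 1ℤ else 0ℤ

𝟙-true : ∀ {P : Set} (P? : Dec P) → P → 𝟙 P? ≡ 1ℤ
𝟙-true P? p rewrite dec-true P? p = refl

𝟙-false : ∀ {P : Set} (P? : Dec P) → ¬ P → 𝟙 P? ≡ 0ℤ
𝟙-false P? ¬p rewrite dec-false P? ¬p = refl

𝟙-⇔ : ∀ {P Q : Set} → P ⇔ Q → (P? : Dec P) (Q? : Dec Q) → 𝟙 P? ≡ 𝟙 Q?
𝟙-⇔ P⇔Q P? Q? rewrite does-⇔ P⇔Q P? Q? = refl

𝟙-gcd : ∀ d a b → 𝟙 (d ∣? gcd a b) ≡ 𝟙 (d ∣? a) *ℤ 𝟙 (d ∣? b)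
𝟙-gcd d a b with d ∣? a | d ∣? b
... | yes d∣a | yes d∣b = 𝟙-true (d ∣? gcd a b) (gcd-greatest d∣a d∣b)
... | yes _   | no  d∤b = 𝟙-false (d ∣? gcd a b) λ d∣g → d∤b (∣-trans d∣g (gcd[m,n]∣n a b))
... | no  d∤a | _       = 𝟙-false (d ∣? gcd a b) λ d∣g → d∤a (∣-trans d∣g (gcd[m,n]∣m a b))

-- Finite sums

sum₁-cong : ∀ n {f g : (d : ℕ) → .{{NonZero d}} → ℤ} →
            (∀ d .{{_ : NonZero d}} → f d ≡ g d) → sum₁ n f ≡ sum₁ n g
sum₁-cong zero    f≗g = refl
sum₁-cong (suc n) f≗g = cong₂ _+ℤ_ (sum₁-cong n f≗g) (f≗g (suc n))

sum₁-+ : ∀ n (f g : (d : ℕ) → .{{NonZero d}} → ℤ) →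
         (Σ[1≤ d ≤ n ] (f d +ℤ g d)) ≡ sum₁ n f +ℤ sum₁ n g
sum₁-+ zero    f g = refl
sum₁-+ (suc n) f g = trans (cong (_+ℤ (f (suc n) +ℤ g (suc n))) (sum₁-+ n f g))
                           (interchange (sum₁ n f) (sum₁ n g) (f (suc n)) (g (suc n)))

sum₁-zero : ∀ n → (Σ[1≤ d ≤ n ] 0ℤ) ≡ 0ℤ
sum₁-zero zero    = refl
sum₁-zero (suc n) = trans (ℤ.+-identityʳ _) (sum₁-zero n)

-- Recursion on `≤′` peels off the vanishing terms above `m`, last one first.
sum₁-extend : ∀ {m n} (f : (d : ℕ) → .{{NonZero d}} → ℤ) →
              (∀ d .{{_ : NonZero d}} → m < d → f d ≡ 0ℤ) → m ≤′ n → sum₁ n f ≡ sum₁ m f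
sum₁-extend f f≡0 ≤′-refl = refl
sum₁-extend {m} {suc n} f f≡0 (≤′-step m≤n) = begin
  sum₁ n f +ℤ f (suc n)  ≡⟨ cong (sum₁ n f +ℤ_) (f≡0 (suc n) (≤-<-trans (≤′⇒≤ m≤n) (n<1+n n))) ⟩
  sum₁ n f +ℤ 0ℤ         ≡⟨ ℤ.+-identityʳ _ ⟩
  sum₁ n f               ≡⟨ sum₁-extend f f≡0 m≤n ⟩
  sum₁ m f               ∎
  where open ≡-Reasoning

-- The application takes `r = 0`; general remainders let the induction remove one term at a time. A
-- last term with nonzero remainder is not divisible by `p` and contributes 0.
sum₁-multiples : ∀ r p q .{{_ : NonZero p}} (f : (d : ℕ) → .{{NonZero d}} → ℤ) → r < p →
                 (Σ[1≤ d ≤ r + q * p ] (𝟙 (p ∣? d) *ℤ f d))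
                 ≡ sum₁ q (λ e → f (e * p) {{m*n≢0 e p}})
sum₁-multiples zero    p@(suc p-1) zero    f r<p = refl
-- `suc q * p` reduces to `suc (p-1 + q * p)`: the last term is a multiple of `p`, and what precedes
-- it has remainder `p-1` and quotient `q`.
sum₁-multiples zero    p@(suc p-1) (suc q) f r<p =
  cong₂ _+ℤ_ (sum₁-multiples p-1 p q f (n<1+n p-1))
    (trans (cong (_*ℤ f (suc q * p)) (𝟙-true (p ∣? (suc q * p)) (n∣m*n (suc q))))
           (ℤ.*-identityˡ _))
sum₁-multiples (suc r) p       q       f r<p = begin
  S +ℤ 𝟙 (p ∣? suc (r + q * p)) *ℤ f (suc (r + q * p))
    ≡⟨ cong (λ x → S +ℤ x *ℤ f (suc (r + q * p))) (𝟙-false (p ∣? _) (∤-remainder q r<p)) ⟩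
  S +ℤ 0ℤ
    ≡⟨ ℤ.+-identityʳ _ ⟩
  S
    ≡⟨ sum₁-multiples r p q f (<-trans (n<1+n r) r<p) ⟩
  sum₁ q (λ e → f (e * p) {{m*n≢0 e p}})
    ∎
  where
  open ≡-Reasoning
  S : ℤ
  S = Σ[1≤ d ≤ r + q * p ] (𝟙 (p ∣? d) *ℤ f d)

-- The Möbius function

module _ {p} (pr : Prime p) (e : ℕ) .{{_ : NonZero e}} where

  private
    instance
      p≢0 : NonZero p
      p≢0 = prime⇒nonZero pr
      e*p≢0 : NonZero (e * p)
      e*p≢0 = m*n≢0 e p

    ps qs : List ℕ
    ps = factors (factorise e)
    qs = factors (factorise (e * p))

    -- `p ∷ ps` is also a prime factorisation of `e * p`, and factorisations are unique up to order.
    qs↭p∷ps : qs ↭ p ∷ ps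
    qs↭p∷ps = factorisationUnique (factorise (e * p)) record
      { factors         = p ∷ ps
      ; isFactorisation = trans (*-comm e p) (cong (p *_) (isFactorisation (factorise e)))
      ; factorsPrime    = pr ∷ factorsPrime (factorise e)
      }

    unique-qs⇔ : Unique qs ⇔ Unique (p ∷ ps)
    unique-qs⇔ = mk⇔ (Permutationₛ.Unique-resp-↭ (setoid ℕ) (↭⇒↭ₛ qs↭p∷ps))
                     (Permutationₛ.Unique-resp-↭ (setoid ℕ) (↭⇒↭ₛ (↭-sym qs↭p∷ps)))

    does-unique-qs : does (unique? _≟_ qs) ≡ does (unique? _≟_ (p ∷ ps))
    does-unique-qs = does-⇔ unique-qs⇔ (unique? _≟_ qs) (unique? _≟_ (p ∷ ps))

  -- Every entry of `ps` divides `e`, so `p` is a new factor: squarefreeness is unchanged and one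
  -- more prime flips the sign.
  μ-*-prime-∤ : p ∤ e → μ (e * p) ≡ - μ e
  μ-*-prime-∤ p∤e = begin
    (if does (unique? _≟_ qs) then -1ℤ ^ℤ length qs else 0ℤ)
      ≡⟨ cong₂ (λ b k → if b then -1ℤ ^ℤ k else 0ℤ)
           (trans does-unique-qs (does-⇔ (mk⇔ (λ { (_ ∷ u) → u }) (p∉ps ∷_)) (unique? _≟_ (p ∷ ps)) (unique? _≟_ ps)))
           (↭-length qs↭p∷ps) ⟩
    (if does (unique? _≟_ ps) then -1ℤ *ℤ -1ℤ ^ℤ length ps else 0ℤ)
      ≡⟨ negate (does (unique? _≟_ ps)) ⟩
    - μ e
      ∎
    where
    open ≡-Reasoning
    p∉ps : All (p ≢_) ps
    p∉ps = ¬Any⇒All¬ ps λ p∈ps →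
      p∤e (subst (p ∣_) (sym (isFactorisation (factorise e))) (∈⇒∣product p∈ps))
    negate : ∀ b → (if b then -1ℤ *ℤ -1ℤ ^ℤ length ps else 0ℤ) ≡ - (if b then -1ℤ ^ℤ length ps else 0ℤ)
    negate true  = ℤ.-1*i≡-i _
    negate false = refl

  -- `p` already occurs in `ps`, so `p ∷ ps` has a repetition.
  μ-*-prime-∣ : p ∣ e → μ (e * p) ≡ 0ℤ
  μ-*-prime-∣ p∣e = cong (λ b → if b then -1ℤ ^ℤ length qs else 0ℤ)
    (trans does-unique-qs (dec-false (unique? _≟_ (p ∷ ps)) λ { (p∉ps ∷ _) → All¬⇒¬Any p∉ps
      (factorisationHasAllPrimeFactors pr (subst (p ∣_) (isFactorisation (factorise e)) p∣e)
        (factorsPrime (factorise e))) }))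

-- Divisor sums of the Möbius function

∃-prime-divisor : ∀ {n} → 1 < n → ∃[ p ] Prime p × p ∣ n
∃-prime-divisor {n@(suc _)} 1<n
  with factors (factorise n) | isFactorisation (factorise n) | factorsPrime (factorise n)
... | []     | n≡1 | _      = contradiction (sym n≡1) (<⇒≢ 1<n)
... | p ∷ ps | n≡∏ | pr ∷ _ = p , pr , subst (p ∣_) (sym n≡∏) (m∣m*n _)

-- Split the divisors d of q p by whether p ∣ d. Those with p ∤ d are the d ∣ q
-- with p ∤ d; those with p ∣ d are e p with e ∣ q, and μ (e p) = - [p ∤ e] μ e,
-- so the two parts cancel.
sum-μ-divisors-q*p : ∀ {p} → Prime p → ∀ q .{{_ : NonZero q}} →
                     (Σ[1≤ d ≤ q * p ] (μ d *ℤ 𝟙 (d ∣? q * p))) ≡ 0ℤ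
sum-μ-divisors-q*p {p} pr q = begin
  (Σ[1≤ d ≤ q * p ] (μ d *ℤ 𝟙 (d ∣? q * p)))
    ≡⟨ sum₁-cong (q * p) (λ d → split d) ⟩
  (Σ[1≤ d ≤ q * p ] (G d +ℤ 𝟙 (p ∣? d) *ℤ F d))
    ≡⟨ sum₁-+ (q * p) G (λ d → 𝟙 (p ∣? d) *ℤ F d) ⟩
  sum₁ (q * p) G +ℤ (Σ[1≤ d ≤ q * p ] (𝟙 (p ∣? d) *ℤ F d))
    -- `G d` contains the bracket of `d ∣ q`, hence vanishes beyond `q`; now both sums run up to `q`
    -- and can be added termwise.
    ≡⟨ cong₂ _+ℤ_ (sum₁-extend G (λ d → G-vanishes d) (≤⇒≤′ (m≤m*n q p)))
                  (sum₁-multiples 0 p q F (>-nonZero⁻¹ p)) ⟩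
  sum₁ q G +ℤ sum₁ q (λ e → F (e * p) {{m*n≢0 e p}})
    ≡⟨ sum₁-+ q G (λ e → F (e * p) {{m*n≢0 e p}}) ⟨
  sum₁ q (λ e → G e +ℤ F (e * p) {{m*n≢0 e p}})
    ≡⟨ sum₁-cong q (λ e → cancel e) ⟩
  (Σ[1≤ d ≤ q ] 0ℤ)
    ≡⟨ sum₁-zero q ⟩
  0ℤ
    ∎
  where
  open ≡-Reasoning

  instance
    p≢0 : NonZero p
    p≢0 = prime⇒nonZero pr

  F G : (d : ℕ) → .{{NonZero d}} → ℤ
  F d = μ d *ℤ 𝟙 (d ∣? q * p)
  G d = 𝟙 (¬? (p ∣? d)) *ℤ (μ d *ℤ 𝟙 (d ∣? q))

  -- A common divisor of `d` and the prime `p` is 1 or `p`, and `p ∤ d` excludes `p`; so `d` is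
  -- coprime to `p`, and the factor `p` can be cancelled.
  ∣q*p⇔∣q : ∀ {d} → p ∤ d → d ∣ q * p ⇔ d ∣ q
  ∣q*p⇔∣q {d} p∤d = mk⇔ (coprime-divisor d⊥p ∘ subst (d ∣_) (*-comm q p)) (∣m⇒∣m*n p)
    where
    d⊥p : Coprime d p
    d⊥p (c∣d , c∣p) with prime⇒irreducible pr c∣p
    ... | inj₁ c≡1  = c≡1
    ... | inj₂ refl = contradiction c∣d p∤d

  split : ∀ d .{{_ : NonZero d}} → F d ≡ G d +ℤ 𝟙 (p ∣? d) *ℤ F d
  split d with p ∣? d
  ... | yes _   = sym (trans (ℤ.+-identityˡ _) (ℤ.*-identityˡ _))
  ... | no  p∤d = trans (cong (μ d *ℤ_) (𝟙-⇔ (∣q*p⇔∣q p∤d) (d ∣? q * p) (d ∣? q)))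
                        (sym (trans (ℤ.+-identityʳ _) (ℤ.*-identityˡ _)))

  G-vanishes : ∀ d .{{_ : NonZero d}} → q < d → G d ≡ 0ℤ
  G-vanishes d q<d rewrite 𝟙-false (d ∣? q) (>⇒∤ q<d) | ℤ.*-zeroʳ (μ d) = ℤ.*-zeroʳ (𝟙 (¬? (p ∣? d)))

  -- If `p ∣ e`, both terms are 0: the first by its bracket, the second because `e * p` is not
  -- squarefree. Otherwise they are opposite.
  cancel : ∀ e .{{_ : NonZero e}} → G e +ℤ F (e * p) {{m*n≢0 e p}} ≡ 0ℤ
  cancel e with p ∣? e
  ... | yes p∣e = trans (ℤ.+-identityˡ _) (cong (_*ℤ 𝟙 (e * p ∣? q * p)) (μ-*-prime-∣ pr e p∣e))
  ... | no  p∤e = begin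
    1ℤ *ℤ x +ℤ μ (e * p) {{m*n≢0 e p}} *ℤ 𝟙 (e * p ∣? q * p)
      ≡⟨ cong₂ (λ a b → 1ℤ *ℤ x +ℤ a *ℤ b) (μ-*-prime-∤ pr e p∤e)
           (𝟙-⇔ (mk⇔ (*-cancelʳ-∣ p) (*-monoˡ-∣ p)) (e * p ∣? q * p) (e ∣? q)) ⟩
    1ℤ *ℤ x +ℤ - μ e *ℤ 𝟙 (e ∣? q)
      ≡⟨ cong₂ _+ℤ_ (ℤ.*-identityˡ x) (sym (ℤ.neg-distribˡ-* (μ e) (𝟙 (e ∣? q)))) ⟩
    x +ℤ - x
      ≡⟨ ℤ.+-inverseʳ x ⟩
    0ℤ
      ∎
    where
    x : ℤ
    x = μ e *ℤ 𝟙 (e ∣? q)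

sum-μ-divisors>1 : ∀ {k} → 1 < k → (Σ[1≤ d ≤ k ] (μ d *ℤ 𝟙 (d ∣? k))) ≡ 0ℤ
sum-μ-divisors>1 1<k with ∃-prime-divisor 1<k
-- A zero quotient would make `k` zero, against `1 < k`.
... | p , pr , divides-refl q@(suc _) = sum-μ-divisors-q*p pr q

-- Divisors of `k` are at most `k`, so the sum may stop there; `k = 1` is a computation, and for
-- `k > 1` a prime divisor gives cancellation.
sum-μ-divisors : ∀ {n} k .{{_ : NonZero k}} → k ≤ n →
                 (Σ[1≤ d ≤ n ] (μ d *ℤ 𝟙 (d ∣? k))) ≡ 𝟙 (k ≟ 1)
sum-μ-divisors {n} k k≤n =
  trans (sum₁-extend (λ d → μ d *ℤ 𝟙 (d ∣? k)) (λ d → vanishes d) (≤⇒≤′ k≤n)) upTo-k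
  where
  vanishes : ∀ d .{{_ : NonZero d}} → k < d → μ d *ℤ 𝟙 (d ∣? k) ≡ 0ℤ
  vanishes d k<d rewrite 𝟙-false (d ∣? k) (>⇒∤ k<d) = ℤ.*-zeroʳ (μ d)

  upTo-k : (Σ[1≤ d ≤ k ] (μ d *ℤ 𝟙 (d ∣? k))) ≡ 𝟙 (k ≟ 1)
  upTo-k with m≤n⇒m<n∨m≡n (>-nonZero⁻¹ k)
  ... | inj₁ 1<k  = trans (sum-μ-divisors>1 1<k) (sym (𝟙-false (k ≟ 1) (<⇒≢ 1<k ∘ sym)))
  ... | inj₂ refl = refl

-- By linearity each entry contributes its own divisor sum, and the seed `1ℤ` contributes `M n`.
sum-μ-foldr : ∀ n ks → All (λ k → NonZero k × k ≤ n) ks →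
              (Σ[1≤ d ≤ n ] (μ d *ℤ foldr (λ k s → 𝟙 (d ∣? k) +ℤ s) 1ℤ ks))
              ≡ foldr (λ k s → 𝟙 (k ≟ 1) +ℤ s) (M n) ks
sum-μ-foldr n [] [] = sum₁-cong n λ d → ℤ.*-identityʳ (μ d)
sum-μ-foldr n (k ∷ ks) ((k≢0 , k≤n) ∷ ps) = begin
  (Σ[1≤ d ≤ n ] (μ d *ℤ (𝟙 (d ∣? k) +ℤ R d)))
    ≡⟨ sum₁-cong n (λ d → ℤ.*-distribˡ-+ (μ d) (𝟙 (d ∣? k)) (R d)) ⟩
  (Σ[1≤ d ≤ n ] (μ d *ℤ 𝟙 (d ∣? k) +ℤ μ d *ℤ R d))
    ≡⟨ sum₁-+ n (λ d → μ d *ℤ 𝟙 (d ∣? k)) (λ d → μ d *ℤ R d) ⟩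
  (Σ[1≤ d ≤ n ] (μ d *ℤ 𝟙 (d ∣? k))) +ℤ (Σ[1≤ d ≤ n ] (μ d *ℤ R d))
    ≡⟨ cong₂ _+ℤ_ (sum-μ-divisors k {{k≢0}} k≤n) (sum-μ-foldr n ks ps) ⟩
  𝟙 (k ≟ 1) +ℤ foldr (λ k s → 𝟙 (k ≟ 1) +ℤ s) (M n) ks
    ∎
  where
  open ≡-Reasoning
  R : ℕ → ℤ
  R d = foldr (λ k s → 𝟙 (d ∣? k) +ℤ s) 1ℤ ks

-- Floor differences

-- Going from `n` to `suc n`, the remainder `r` of `n` grows by one and the quotient stays, unless
-- `1 + r = d`; then `d ∣ suc n` and the quotient grows by one.
n/d∸[n∸1]/d : ∀ n d .{{_ : NonZero n}} .{{_ : NonZero d}} →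
              n / d ∸ (n ∸ 1) / d ≡ (if does (d ∣? n) then 1 else 0)
n/d∸[n∸1]/d (suc n) d with m≤n⇒m<n∨m≡n (m%n<n n d)
... | inj₁ 1+r<d = begin
  suc n / d ∸ n / d
    ≡⟨ cong (λ k → k / d ∸ n / d) 1+n≡ ⟩
  (suc (n % d) + n / d * d) / d ∸ n / d
    ≡⟨ cong (_∸ n / d) (+-distrib-/-∣ʳ (suc (n % d)) (n∣m*n (n / d))) ⟩
  suc (n % d) / d + n / d * d / d ∸ n / d
    ≡⟨ cong₂ (λ a b → a + b ∸ n / d) (m<n⇒m/n≡0 1+r<d) (m*n/n≡m (n / d) d) ⟩
  n / d ∸ n / d
    ≡⟨ n∸n≡0 (n / d) ⟩
  0
    ≡⟨ cong (if_then 1 else 0) (dec-false (d ∣? suc n) d∤1+n) ⟨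
  (if does (d ∣? suc n) then 1 else 0)
    ∎
  where
  open ≡-Reasoning
  1+n≡ : suc n ≡ suc (n % d) + n / d * d
  1+n≡ = cong suc (m≡m%n+[m/n]*n n d)
  d∤1+n : d ∤ suc n
  d∤1+n = ∤-remainder (n / d) 1+r<d ∘ subst (d ∣_) 1+n≡
... | inj₂ 1+r≡d = begin
  suc n / d ∸ n / d
    ≡⟨ cong (λ k → k / d ∸ n / d) 1+n≡ ⟩
  suc (n / d) * d / d ∸ n / d
    ≡⟨ cong (_∸ n / d) (m*n/n≡m (suc (n / d)) d) ⟩
  suc (n / d) ∸ n / d
    ≡⟨ m+n∸n≡m 1 (n / d) ⟩
  1
    ≡⟨ cong (if_then 1 else 0) (dec-true (d ∣? suc n) (divides (suc (n / d)) 1+n≡)) ⟨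
  (if does (d ∣? suc n) then 1 else 0)
    ∎
  where
  open ≡-Reasoning
  1+n≡ : suc n ≡ suc (n / d) * d
  1+n≡ = trans (cong suc (m≡m%n+[m/n]*n n d)) (cong (_+ n / d * d) 1+r≡d)

-- Expansion of the power of 2

gcds : ℕ → ℕ → ℕ → List ℕ
-- One entry for each nonempty subset of the three labels. The singletons lead, so that their
-- brackets can later be dropped from the head of the fold.
gcds l m n = l ∷ m ∷ n ∷ gcd l m ∷ gcd l n ∷ gcd m n ∷ gcd (gcd l m) n ∷ []

-- After rewriting, both sides depend on three Booleans only, and each of the eight cases holds by
-- evaluation.
2^-expand : ∀ l m n d .{{_ : NonZero l}} .{{_ : NonZero m}} .{{_ : NonZero n}} .{{_ : NonZero d}} →
  (+ 2) ^ℤ ((n / d ∸ (n ∸ 1) / d) + (m / d ∸ (m ∸ 1) / d) + (l / d ∸ (l ∸ 1) / d))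
  ≡ foldr (λ k s → 𝟙 (d ∣? k) +ℤ s) 1ℤ (gcds l m n)
2^-expand l m n d {{l≢0}} {{m≢0}} {{n≢0}} {{d≢0}}
  rewrite n/d∸[n∸1]/d n d {{n≢0}} {{d≢0}} | n/d∸[n∸1]/d m d {{m≢0}} {{d≢0}} | n/d∸[n∸1]/d l d {{l≢0}} {{d≢0}}
        -- The triple gcd comes first: it produces a bracket for `gcd l m`, which the next rewrite
        -- splits together with the original one.
        | 𝟙-gcd d (gcd l m) n | 𝟙-gcd d l m | 𝟙-gcd d l n | 𝟙-gcd d m n
  with does (d ∣? l) | does (d ∣? m) | does (d ∣? n)
... | false | false | false = refl
... | false | false | true  = refl
... | false | true  | false = refl
... | false | true  | true  = refl
... | true  | false | false = refl
... | true  | false | true  = refl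
... | true  | true  | false = refl
... | true  | true  | true  = refl

-- Counting coprime pairs

does-true⁻¹ : ∀ {P : Set} (P? : Dec P) → does P? ≡ true → P
does-true⁻¹ (yes p) refl = p

-- `g` divides `gcd a b`, which is 1. Boolean equations are used so that `count-cases` can abstract
-- both tests.
coprime⇒common-divisor≡1 : ∀ {g} a b → g ∣ a → g ∣ b →
                           does (gcd a b ≟ 1) ≡ true → does (g ≟ 1) ≡ true
coprime⇒common-divisor≡1 {g} a b g∣a g∣b eq = dec-true (g ≟ 1)
  (∣1⇒≡1 (subst (g ∣_) (does-true⁻¹ (gcd a b ≟ 1) eq) (gcd-greatest g∣a g∣b)))

length-filter-∷ : ∀ {A : Set} {P : A → Set} (P? : ∀ x → Dec (P x)) x xs →
                  length (filter P? (x ∷ xs)) ≡ (if does (P? x) then 1 else 0) + length (filter P? xs)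
length-filter-∷ P? x xs with does (P? x)
... | true  = refl
... | false = refl

-- `coprime?` computes to the test of the gcd against 1, so the count depends on the same Booleans
-- as the brackets.
#coprimePairs-sum : ∀ l m n → #coprimePairs l m n ≡
  (if does (gcd l m ≟ 1) then 1 else 0) + ((if does (gcd l n ≟ 1) then 1 else 0) +
    ((if does (gcd m n ≟ 1) then 1 else 0) + 0))
#coprimePairs-sum l m n =
  trans (count-∷ (l , m) ((l , n) ∷ (m , n) ∷ []))
    (cong (λ k → (if does (gcd l m ≟ 1) then 1 else 0) + k)
      (trans (count-∷ (l , n) ((m , n) ∷ []))
        (cong (λ k → (if does (gcd l n ≟ 1) then 1 else 0) + k) (count-∷ (m , n) []))))
  where
  count-∷ = length-filter-∷ (uncurry coprime?)

-- One coprime pair already forces the triple gcd to be 1. Hence `j ≥ 1` coprime pairs give `j + 1`,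
-- and with no such pair only the triple bracket remains.
count-cases : ∀ l m n x →
  𝟙 (gcd l m ≟ 1) +ℤ 𝟙 (gcd l n ≟ 1) +ℤ 𝟙 (gcd m n ≟ 1) +ℤ 𝟙 (gcd (gcd l m) n ≟ 1) +ℤ x
  ≡
  (if does (gcd l m ≟ 1 ×-dec gcd l n ≟ 1 ×-dec gcd m n ≟ 1) then + 4 +ℤ x
   else if does (#coprimePairs l m n ≟ 2) then + 3 +ℤ x
   else if does (#coprimePairs l m n ≟ 1) then + 2 +ℤ x
   else if does (#coprimePairs l m n ≟ 0 ×-dec gcd (gcd l m) n ≟ 1) then + 1 +ℤ x
   else x)
count-cases l m n x
  rewrite #coprimePairs-sum l m n
  with does (gcd l m ≟ 1) | does (gcd l n ≟ 1) | does (gcd m n ≟ 1) | does (gcd (gcd l m) n ≟ 1)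
     -- Abstracted along with the Booleans, these implications become `true ≡ true → false ≡ true`
     -- in the impossible rows.
     | coprime⇒common-divisor≡1 l m g∣l g∣m
     | coprime⇒common-divisor≡1 l n g∣l g∣n
     | coprime⇒common-divisor≡1 m n g∣m g∣n
  where
  g∣l : gcd (gcd l m) n ∣ l
  g∣l = ∣-trans (gcd[m,n]∣m (gcd l m) n) (gcd[m,n]∣m l m)
  g∣m : gcd (gcd l m) n ∣ m
  g∣m = ∣-trans (gcd[m,n]∣m (gcd l m) n) (gcd[m,n]∣n l m)
  g∣n : gcd (gcd l m) n ∣ n
  g∣n = gcd[m,n]∣n (gcd l m) n
... | true  | _     | _     | false | h | _ | _ = contradiction (h refl) λ ()
... | false | true  | _     | false | _ | h | _ = contradiction (h refl) λ ()
... | false | false | true  | false | _ | _ | h = contradiction (h refl) λ ()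
... | false | false | false | false | _ | _ | _ = ℤ.+-identityˡ x
... | true  | true  | true  | true  | _ | _ | _ = refl
... | true  | true  | false | true  | _ | _ | _ = refl
... | true  | false | true  | true  | _ | _ | _ = refl
... | true  | false | false | true  | _ | _ | _ = refl
... | false | true  | true  | true  | _ | _ | _ = refl
... | false | true  | false | true  | _ | _ | _ = refl
... | false | false | true  | true  | _ | _ | _ = refl
... | false | false | false | true  | _ | _ | _ = refl

-- Evaluation of the sum

theorem4p2 : (l m n : ℕ) → 1 < l → l < m → m ≤ n →
    (Σ[1≤ d ≤ n ] (μ d *ℤ (+ 2) ^ℤ ((n / d ∸ (n ∸ 1) / d) + (m / d ∸ (m ∸ 1) / d) + (l / d ∸ (l ∸ 1) / d))))
    ≡
    (if does (gcd l m ≟ 1 ×-dec gcd l n ≟ 1 ×-dec gcd m n ≟ 1) then + 4 +ℤ M n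
    else if does (#coprimePairs l m n ≟ 2) then + 3 +ℤ M n
    else if does (#coprimePairs l m n ≟ 1) then + 2 +ℤ M n
    else if does (#coprimePairs l m n ≟ 0 ×-dec gcd (gcd l m) n ≟ 1) then + 1 +ℤ M n
    else M n)
theorem4p2 l m n 1<l l<m m≤n = begin
  (Σ[1≤ d ≤ n ] (μ d *ℤ (+ 2) ^ℤ ((n / d ∸ (n ∸ 1) / d) + (m / d ∸ (m ∸ 1) / d) + (l / d ∸ (l ∸ 1) / d))))
    ≡⟨ sum₁-cong n (λ d → cong (μ d *ℤ_) (2^-expand l m n d)) ⟩
  (Σ[1≤ d ≤ n ] (μ d *ℤ foldr (λ k s → 𝟙 (d ∣? k) +ℤ s) 1ℤ (gcds l m n)))
    ≡⟨ sum-μ-foldr n (gcds l m n)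
         ( divisor l l≤n ∣-refl ∷ divisor m m≤n ∣-refl ∷ divisor n ≤-refl ∣-refl
         ∷ divisor l l≤n (gcd[m,n]∣m l m) ∷ divisor l l≤n (gcd[m,n]∣m l n) ∷ divisor m m≤n (gcd[m,n]∣m m n)
         ∷ divisor n ≤-refl (gcd[m,n]∣n (gcd l m) n) ∷ []) ⟩
  foldr (λ k s → 𝟙 (k ≟ 1) +ℤ s) (M n) (gcds l m n)
    -- `l`, `m` and `n` exceed 1, so their own brackets vanish and only those of the gcds survive.
    ≡⟨ trans (drop 1<l _) (trans (drop 1<m _) (drop 1<n _)) ⟩
  𝟙 (gcd l m ≟ 1) +ℤ (𝟙 (gcd l n ≟ 1) +ℤ (𝟙 (gcd m n ≟ 1) +ℤ (𝟙 (gcd (gcd l m) n ≟ 1) +ℤ M n)))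
    ≡⟨ reassociate (𝟙 (gcd l m ≟ 1)) (𝟙 (gcd l n ≟ 1)) (𝟙 (gcd m n ≟ 1)) (𝟙 (gcd (gcd l m) n ≟ 1)) (M n) ⟩
  𝟙 (gcd l m ≟ 1) +ℤ 𝟙 (gcd l n ≟ 1) +ℤ 𝟙 (gcd m n ≟ 1) +ℤ 𝟙 (gcd (gcd l m) n ≟ 1) +ℤ M n
    ≡⟨ count-cases l m n (M n) ⟩
  _
    ∎
  where
  open ≡-Reasoning

  1<m : 1 < m
  1<m = <-trans 1<l l<m
  1<n : 1 < n
  1<n = <-≤-trans 1<m m≤n
  l≤n : l ≤ n
  l≤n = ≤-trans (<⇒≤ l<m) m≤n

  instance
    l≢0 : NonZero l
    l≢0 = >-nonZero (<-trans z<s 1<l)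
    m≢0 : NonZero m
    m≢0 = >-nonZero (<-trans z<s 1<m)
    n≢0 : NonZero n
    n≢0 = >-nonZero (<-trans z<s 1<n)

  divisor : ∀ a .{{_ : NonZero a}} → a ≤ n → ∀ {k} → k ∣ a → NonZero k × k ≤ n
  divisor a a≤n {zero}  0∣a = contradiction (0∣⇒≡0 0∣a) (≢-nonZero⁻¹ a)
  divisor a a≤n {suc k} k∣a = _ , ≤-trans (∣⇒≤ k∣a) a≤n

  drop : ∀ {k} → 1 < k → ∀ x → 𝟙 (k ≟ 1) +ℤ x ≡ x
  drop {k} 1<k x = trans (cong (_+ℤ x) (𝟙-false (k ≟ 1) (<⇒≢ 1<k ∘ sym))) (ℤ.+-identityˡ x)

  reassociate : ∀ a b c d x → a +ℤ (b +ℤ (c +ℤ (d +ℤ x))) ≡ a +ℤ b +ℤ c +ℤ d +ℤ x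
  reassociate a b c d x = sym (begin
    a +ℤ b +ℤ c +ℤ d +ℤ x          ≡⟨ ℤ.+-assoc (a +ℤ b +ℤ c) d x ⟩
    a +ℤ b +ℤ c +ℤ (d +ℤ x)        ≡⟨ ℤ.+-assoc (a +ℤ b) c (d +ℤ x) ⟩
    a +ℤ b +ℤ (c +ℤ (d +ℤ x))      ≡⟨ ℤ.+-assoc a b (c +ℤ (d +ℤ x)) ⟩
    a +ℤ (b +ℤ (c +ℤ (d +ℤ x)))    ∎)
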